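{- Let a graph $G=(V,E)$ be covered by graphs $G_1=(V,E_1),G_2=(V,E_2),\dots,G_k=(V,E_k)$, that is, $E=E_1\cup\dots\cup E_k$. If, for $i=1,2,\dots,k$, weighted Max-Crown on the graph $G_i$ admits an $\alpha_i$-approximation, then weighted Max-Crown on $G$ admits a $\left(\sum_{i=1}^k\alpha_i\right)$-approximation.
   Context: An instance of (weighted) Max-Crown is a graph $G=(V,E)$, a box (axis-aligned rectangle) $B_v$ of given width $w(v)>0$ and height $h(v)>0$ for each vertex $v\in V$, and a positive profit $p(e)$ for each edge $e\in E$. For a point $q$ in the plane, $B_v(q)$ denotes the placement of $B_v$ with lower left corner $q$ (no rotation). A representation of $G$ is a map $\lambda\colon V\to\mathbb{R}^2$ such that for any two vertices $u\neq v$ the placed boxes $B_u(\lambda(u))$ and $B_v(\lambda(v))$ are interior-disjoint. Two boxes are in contact if their intersection contains a line segment of positive length (touching in a single point does not count). A representation realizes an edge $(u,v)\in E$ if $B_u(\lambda(u))$ and $B_v(\lambda(v))$ are in contact. The goal is to find a representation maximizing the total profit of the realized edges; $\mathrm{OPT}$ denotes the maximum. An $\alpha$-approximation is a polynomial-time algorithm that computes a representation whose total profit of realized edges is at least $\mathrm{OPT}/\alpha$. The instances on $G_1,\dots,G_k$ use the same vertex boxes as the instance on $G$ and the same edge profits, restricted to $E_i$. The covering graphs $G_1,\dots,G_k$ are available to the algorithm for $G$. -}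

module Defs where

open import Algebra.Bundles using (CommutativeRing)
open import Algebra.Structures using (IsCommutativeRing)
open import Data.Bool.Base using (Bool; true; false; if_then_else_; _∧_)
open import Data.Fin.Base using (Fin)
import Data.Fin.Properties as Fin
open import Data.Nat.Base as ℕ using (ℕ; suc)
open import Data.Product.Base using (Σ; ∃; ∃-syntax; Σ-syntax; _×_; _,_; proj₁; proj₂)
open import Data.Sum.Base using (_⊎_; inj₁; inj₂; [_,_]′)
import Data.Vec.Functional as Vector
open import Function.Base using (_∘_)
open import Function.Bundles using (_⇔_)
open import Level using (0ℓ)
open import Relation.Binary.Bundles using (TotalOrder)
open import Relation.Binary.Core using (Rel)
open import Relation.Binary.PropositionalEquality.Core using (_≡_)
open import Relation.Binary.Structures using (IsStrictTotalOrder)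
import Relation.Binary.Construct.StrictToNonStrict as NonStrict
open import Relation.Nullary.Decidable using (Dec; ⌊_⌋; map′; _×-dec_; _⊎-dec_)
open import Relation.Nullary.Negation using (¬_; contradiction)
open import Relation.Binary.Definitions using (tri<; tri≈; tri>)

------------------------------------------------------------------------
-- The real numbers

-- The classical axioms of a Dedekind-complete ordered field, which determine
-- ℝ up to isomorphism.  Equality is a setoid equality, and the inverse of 0#
-- is an unspecified value.

record RealNumbers : Set₁ where
  infix  8 _⁻¹
  infix  8 -_
  infixl 7 _*_
  infixl 6 _+_ _-_
  infix  4 _≈_ _<_ _≤_
  field
    Carrier            : Set
    _≈_                : Rel Carrier 0ℓ
    _<_                : Rel Carrier 0ℓ
    _+_ _*_            : Carrier → Carrier → Carrier
    -_                 : Carrier → Carrier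
    0# 1#              : Carrier
    _⁻¹                : Carrier → Carrier
    isCommutativeRing  : IsCommutativeRing _≈_ _+_ _*_ -_ 0# 1#
    isStrictTotalOrder : IsStrictTotalOrder _≈_ _<_
    0≉1                : ¬ 0# ≈ 1#
    ⁻¹-inverseʳ        : ∀ {x} → ¬ x ≈ 0# → x * x ⁻¹ ≈ 1#
    +-monoˡ-<          : ∀ z {x y} → x < y → x + z < y + z
    *-pos              : ∀ {x y} → 0# < x → 0# < y → 0# < x * y

  _≤_ : Rel Carrier 0ℓ
  _≤_ = NonStrict._≤_ _≈_ _<_

  field
    supremum : (P : Carrier → Set) → ∃ P →
               (∃[ b ] (∀ x → P x → x ≤ b)) →
               ∃[ s ] (∀ x → P x → x ≤ s) ×
                      (∀ b → (∀ x → P x → x ≤ b) → s ≤ b)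

  _-_ : Carrier → Carrier → Carrier
  x - y = x + - y

  commutativeRing : CommutativeRing 0ℓ 0ℓ
  commutativeRing = record { isCommutativeRing = isCommutativeRing }

  totalOrder : TotalOrder 0ℓ 0ℓ 0ℓ
  totalOrder = record
    { isTotalOrder = NonStrict.isTotalOrder _≈_ _<_ isStrictTotalOrder }

module RealProperties (R : RealNumbers) where

  open RealNumbers R
  open CommutativeRing commutativeRing
    using ( refl; sym; trans; +-comm; +-assoc; +-identityˡ; +-identityʳ; +-cong
          ; +-congʳ; +-congˡ; *-congʳ; *-congˡ; *-identityˡ
          ; distribˡ; distribʳ; zeroˡ; zeroʳ; -‿inverseʳ; -‿inverseˡ)
  open IsStrictTotalOrder isStrictTotalOrder using (compare; irrefl; <-resp-≈)
    renaming (trans to <-trans)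
  open TotalOrder totalOrder using (≤-respˡ-≈; ≤-respʳ-≈)
    renaming (trans to ≤-trans)
  open import Algebra.Properties.Ring (CommutativeRing.ring commutativeRing)
    using (-0#≈0#; -1*x≈-x; -‿involutive)

  0<1 : 0# < 1#
  0<1 with compare 0# 1#
  ... | tri< 0<1 _ _   = 0<1
  ... | tri≈ _ 0≈1 _   = contradiction 0≈1 0≉1
  ... | tri> _ _ 1<0   = contradiction (<-trans 0<1′ 1<0) (irrefl refl)
    where
    0<-1 : 0# < - 1#
    0<-1 = proj₁ <-resp-≈ (+-identityˡ _)
             (proj₂ <-resp-≈ (-‿inverseʳ 1#) (+-monoˡ-< (- 1#) 1<0))
    0<1′ : 0# < 1#
    0<1′ = proj₁ <-resp-≈ (trans (-1*x≈-x (- 1#)) (-‿involutive 1#)) (*-pos 0<-1 0<-1)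

  +-monoˡ-≤ : ∀ z {x y} → x ≤ y → x + z ≤ y + z
  +-monoˡ-≤ z = [ inj₁ ∘ +-monoˡ-< z , inj₂ ∘ +-congʳ ]′

  +-mono-≤ : ∀ {x y z w} → x ≤ y → z ≤ w → x + z ≤ y + w
  +-mono-≤ {x} {y} {z} {w} x≤y z≤w = ≤-trans (+-monoˡ-≤ z x≤y)
    (≤-respˡ-≈ (+-comm z y) (≤-respʳ-≈ (+-comm w y) (+-monoˡ-≤ y z≤w)))

  x≤y⇒0≤y-x : ∀ {x y} → x ≤ y → 0# ≤ y - x
  x≤y⇒0≤y-x {x} x≤y = ≤-respˡ-≈ (-‿inverseʳ x) (+-monoˡ-≤ (- x) x≤y)

  cancel : ∀ x y → (x - y) + y ≈ x
  cancel x y = trans (+-assoc x (- y) y) (trans (+-congˡ (-‿inverseˡ y)) (+-identityʳ x))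

  *-nonneg : ∀ {x y} → 0# ≤ x → 0# ≤ y → 0# ≤ x * y
  *-nonneg (inj₁ 0<x) (inj₁ 0<y) = inj₁ (*-pos 0<x 0<y)
  *-nonneg (inj₂ 0≈x) _          = inj₂ (sym (trans (*-congʳ (sym 0≈x)) (zeroˡ _)))
  *-nonneg (inj₁ _)   (inj₂ 0≈y) = inj₂ (sym (trans (*-congˡ (sym 0≈y)) (zeroʳ _)))

  *-monoˡ-≤ : ∀ {c x y} → 0# ≤ c → x ≤ y → c * x ≤ c * y
  *-monoˡ-≤ {c} {x} {y} 0≤c x≤y = ≤-respʳ-≈ eq
    (≤-respˡ-≈ (+-identityˡ _) (+-monoˡ-≤ (c * x) (*-nonneg 0≤c (x≤y⇒0≤y-x x≤y))))
    where
    eq : c * (y - x) + c * x ≈ c * y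
    eq = trans (sym (distribˡ c (y - x) x)) (*-congˡ (cancel y x))

  along : Carrier → Carrier → Carrier → Carrier
  along t x y = (1# - t) * x + t * y

  along-const : ∀ t x → along t x x ≈ x
  along-const t x = trans (sym (distribʳ x (1# - t) t))
                          (trans (*-congʳ (cancel 1# t)) (*-identityˡ x))

  along-0 : ∀ x y → along 0# x y ≈ x
  along-0 x y = trans
    (+-cong (trans (*-congʳ (trans (+-congˡ -0#≈0#) (+-identityʳ 1#))) (*-identityˡ x))
            (zeroˡ y))
    (+-identityʳ x)

  along-1 : ∀ x y → along 1# x y ≈ y
  along-1 x y = trans
    (+-cong (trans (*-congʳ (-‿inverseʳ 1#)) (zeroˡ x)) (*-identityˡ y))
    (+-identityˡ y)

  along-mono : ∀ {t x x′ y y′} → 0# ≤ t → t ≤ 1# → x ≤ x′ → y ≤ y′ →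
               along t x y ≤ along t x′ y′
  along-mono 0≤t t≤1 x≤x′ y≤y′ =
    +-mono-≤ (*-monoˡ-≤ (x≤y⇒0≤y-x t≤1) x≤x′) (*-monoˡ-≤ 0≤t y≤y′)

  along-≥ : ∀ {t a x y} → 0# ≤ t → t ≤ 1# → a ≤ x → a ≤ y → a ≤ along t x y
  along-≥ 0≤t t≤1 a≤x a≤y = ≤-respˡ-≈ (along-const _ _) (along-mono 0≤t t≤1 a≤x a≤y)

  along-≤ : ∀ {t a x y} → 0# ≤ t → t ≤ 1# → x ≤ a → y ≤ a → along t x y ≤ a
  along-≤ 0≤t t≤1 x≤a y≤a = ≤-respʳ-≈ (along-const _ _) (along-mono 0≤t t≤1 x≤a y≤a)

------------------------------------------------------------------------
-- Finite simple graphs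

record Graph (n : ℕ) : Set where
  field
    adj    : Fin n → Fin n → Bool
    sym    : ∀ u v → adj u v ≡ adj v u
    irrefl : ∀ v → adj v v ≡ false

GraphClass : Set₁
GraphClass = ∀ {n} → Graph n → Set

_Covers_ : ∀ {n k} → (Fin k → Graph n) → Graph n → Set
Gs Covers G = ∀ u v → Graph.adj G u v ≡ true ⇔ (∃[ i ] Graph.adj (Gs i) u v ≡ true)

------------------------------------------------------------------------
-- Programs

-- A while language over binary trees (as in Jones, "Computability and
-- Complexity from a Programming Perspective") in point-free form, extended
-- with the unit-cost real arithmetic and comparisons of the real RAM.  The
-- only real constants are 0 and 1, and there is no rounding operation.

infixr 5 _⨾_

data Prog : Set where
  id nil hd tl                : Prog
  ⟨_,_⟩                       : Prog → Prog → Prog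
  _⨾_                         : Prog → Prog → Prog
  cond                        : Prog → Prog → Prog → Prog
  while                       : Prog → Prog → Prog
  `0 `1 `+ `- `* `/ `<        : Prog

module MaxCrown (R : RealNumbers) where

  open RealNumbers R
  open RealProperties R
  open CommutativeRing commutativeRing using (+-commutativeMonoid)
  open IsStrictTotalOrder isStrictTotalOrder using (compare; irrefl)
    renaming (_<?_ to _<ᵣ?_)
  open TotalOrder totalOrder using (≤-respˡ-≈; ≤-respʳ-≈; antisym)
    renaming (trans to ≤-trans; refl to ≤-refl)
  open import Algebra.Properties.CommutativeMonoid.Sum +-commutativeMonoid
    using (sum-syntax) public
  open import Algebra.Construct.NaturalChoice.Max totalOrder
    using (_⊔_; x≤x⊔y; x≤y⊔x; ⊔-lub)
  open import Algebra.Construct.NaturalChoice.Min totalOrder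
    using (_⊓_; x⊓y≤x; x⊓y≤y; ⊓-glb)

  ----------------------------------------------------------------------
  -- Placed boxes

  Point : Set
  Point = Carrier × Carrier

  _≈ₚ_ : Rel Point 0ℓ
  (x , y) ≈ₚ (x′ , y′) = x ≈ x′ × y ≈ y′

  -- corner is the lower left corner.
  record Box : Set where
    constructor box
    field
      corner       : Point
      width height : Carrier

  _∈_ : Point → Box → Set
  (x , y) ∈ box (a , b) w h = (a ≤ x × x ≤ a + w) × (b ≤ y × y ≤ b + h)

  _∈Interior_ : Point → Box → Set
  (x , y) ∈Interior box (a , b) w h = (a < x × x < a + w) × (b < y × y < b + h)

  InteriorDisjoint : Rel Box 0ℓ
  InteriorDisjoint B B′ = ∀ q → ¬ (q ∈Interior B × q ∈Interior B′)

  -- The point at parameter t on the segment from the first point to the second.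
  segment : Point → Point → Carrier → Point
  segment (x , y) (x′ , y′) t = along t x x′ , along t y y′

  Contact : Rel Box 0ℓ
  Contact B B′ =
    ∃[ a ] ∃[ b ] ¬ (a ≈ₚ b) ×
      (∀ t → 0# ≤ t → t ≤ 1# → segment a b t ∈ B × segment a b t ∈ B′)

  -- Contact is decidable: the intersection of two boxes is [l,r] × [d,u], and
  -- it contains a proper segment iff it is non-empty and not a single point.
  contact? : ∀ B B′ → Dec (Contact B B′)
  contact? (box (a , b) w h) (box (a′ , b′) w′ h′) =
    map′ from to ((l ≤? r) ×-dec (d ≤? u) ×-dec ((l <ᵣ? r) ⊎-dec (d <ᵣ? u)))
    where
    B  = box (a , b) w h
    B′ = box (a′ , b′) w′ h′
    l = a ⊔ a′
    r = (a + w) ⊓ (a′ + w′)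
    d = b ⊔ b′
    u = (b + h) ⊓ (b′ + h′)
    _≤?_ = NonStrict.decidable′ _≈_ _<_ compare

    from : l ≤ r × d ≤ u × (l < r ⊎ d < u) → Contact B B′
    from (l≤r , d≤u , l<r⊎d<u) = (l , d) , (r , u) , distinct , inside
      where
      distinct : ¬ (l , d) ≈ₚ (r , u)
      distinct (l≈r , d≈u) = [ irrefl l≈r , irrefl d≈u ]′ l<r⊎d<u
      inside : ∀ t → 0# ≤ t → t ≤ 1# →
               segment (l , d) (r , u) t ∈ B × segment (l , d) (r , u) t ∈ B′
      inside t 0≤t t≤1 =
        ( ( ≤-trans (x≤x⊔y a a′) l≤p , ≤-trans p≤r (x⊓y≤x (a + w) (a′ + w′)))
        , ( ≤-trans (x≤x⊔y b b′) d≤q , ≤-trans q≤u (x⊓y≤x (b + h) (b′ + h′)))) ,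
        ( ( ≤-trans (x≤y⊔x a a′) l≤p , ≤-trans p≤r (x⊓y≤y (a + w) (a′ + w′)))
        , ( ≤-trans (x≤y⊔x b b′) d≤q , ≤-trans q≤u (x⊓y≤y (b + h) (b′ + h′))))
        where
        l≤p = along-≥ 0≤t t≤1 ≤-refl l≤r
        p≤r = along-≤ 0≤t t≤1 l≤r ≤-refl
        d≤q = along-≥ 0≤t t≤1 ≤-refl d≤u
        q≤u = along-≤ 0≤t t≤1 d≤u ≤-refl

    to : Contact B B′ → l ≤ r × d ≤ u × (l < r ⊎ d < u)
    to ((x₀ , y₀) , (x₁ , y₁) , distinct , inside)
      with inside 0# ≤-refl (inj₁ 0<1) | inside 1# (inj₁ 0<1) ≤-refl
    ... | (((p₁ , p₂) , (p₃ , p₄)) , ((p₅ , p₆) , (p₇ , p₈)))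
        | (((q₁ , q₂) , (q₃ , q₄)) , ((q₅ , q₆) , (q₇ , q₈))) =
      ≤-trans l≤x₀ x₀≤r , ≤-trans d≤y₀ y₀≤u , strict
      where
      l≤x₀ = ≤-respʳ-≈ (along-0 x₀ x₁) (⊔-lub p₁ p₅)
      x₀≤r = ≤-respˡ-≈ (along-0 x₀ x₁) (⊓-glb p₂ p₆)
      d≤y₀ = ≤-respʳ-≈ (along-0 y₀ y₁) (⊔-lub p₃ p₇)
      y₀≤u = ≤-respˡ-≈ (along-0 y₀ y₁) (⊓-glb p₄ p₈)
      l≤x₁ = ≤-respʳ-≈ (along-1 x₀ x₁) (⊔-lub q₁ q₅)
      x₁≤r = ≤-respˡ-≈ (along-1 x₀ x₁) (⊓-glb q₂ q₆)
      d≤y₁ = ≤-respʳ-≈ (along-1 y₀ y₁) (⊔-lub q₃ q₇)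
      y₁≤u = ≤-respˡ-≈ (along-1 y₀ y₁) (⊓-glb q₄ q₈)

      squeeze : ∀ {m n x y} → m ≈ n → m ≤ x → x ≤ n → m ≤ y → y ≤ n → x ≈ y
      squeeze m≈n m≤x x≤n m≤y y≤n = antisym
        (≤-trans x≤n (≤-respˡ-≈ m≈n m≤y)) (≤-trans y≤n (≤-respˡ-≈ m≈n m≤x))

      strict : l < r ⊎ d < u
      strict with ≤-trans l≤x₀ x₀≤r | ≤-trans d≤y₀ y₀≤u
      ... | inj₁ l<r | _        = inj₁ l<r
      ... | inj₂ _   | inj₁ d<u = inj₂ d<u
      ... | inj₂ l≈r | inj₂ d≈u = contradiction
        (squeeze l≈r l≤x₀ x₀≤r l≤x₁ x₁≤r , squeeze d≈u d≤y₀ y₀≤u d≤y₁ y₁≤u) distinct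

  ----------------------------------------------------------------------
  -- Weighted Max-Crown

  -- The values of profit on non-edges are junk: neither the objective nor the
  -- encoding of an instance depends on them.
  record Instance (n : ℕ) : Set where
    field
      graph      : Graph n
      w h        : Fin n → Carrier
      w-pos      : ∀ v → 0# < w v
      h-pos      : ∀ v → 0# < h v
      profit     : Fin n → Fin n → Carrier
      profit-sym : ∀ u v → Graph.adj graph u v ≡ true → profit u v ≈ profit v u
      profit-pos : ∀ u v → Graph.adj graph u v ≡ true → 0# < profit u v

    open Graph graph public using (adj)

    place : (Fin n → Point) → Fin n → Box
    place pos v = box (pos v) (w v) (h v)

    IsRepresentation : (Fin n → Point) → Set
    IsRepresentation pos =
      ∀ u v → ¬ u ≡ v → InteriorDisjoint (place pos u) (place pos v)

    -- Each edge is counted once, as the pair (u , v) with u < v.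
    totalProfit : (Fin n → Point) → Carrier
    totalProfit pos = ∑[ u < n ] ∑[ v < n ]
      (if ⌊ u Fin.<? v ⌋ ∧ adj u v ∧ ⌊ contact? (place pos u) (place pos v) ⌋
       then profit u v else 0#)

    IsOPT : Carrier → Set
    IsOPT m =
      (∃[ pos ] IsRepresentation pos × totalProfit pos ≈ m) ×
      (∀ pos → IsRepresentation pos → totalProfit pos ≤ m)

  ----------------------------------------------------------------------
  -- Execution of programs

  infixr 5 _∷_

  data Data : Set where
    nil : Data
    num : Carrier → Data
    _∷_ : Data → Data → Data

  size : Data → ℕ
  size nil     = 1
  size (num _) = 1
  size (d ∷ e) = suc (size d ℕ.+ size e)

  -- p ⊢ d ⇓ e ∣ t : on input d, program p halts with output e after t steps.
  -- In tests nil is false and every other tree is true.  Ill-typed operations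
  -- and division by zero get stuck.
  infix 4 _⊢_⇓_∣_

  data _⊢_⇓_∣_ : Prog → Data → Data → ℕ → Set where
    id         : ∀ {d} → id ⊢ d ⇓ d ∣ 1
    nil        : ∀ {d} → nil ⊢ d ⇓ nil ∣ 1
    hd         : ∀ {d e} → hd ⊢ d ∷ e ⇓ d ∣ 1
    tl         : ∀ {d e} → tl ⊢ d ∷ e ⇓ e ∣ 1
    pair       : ∀ {p q d e f s t} → p ⊢ d ⇓ e ∣ s → q ⊢ d ⇓ f ∣ t →
                 ⟨ p , q ⟩ ⊢ d ⇓ e ∷ f ∣ suc (s ℕ.+ t)
    seq        : ∀ {p q d e f s t} → p ⊢ d ⇓ e ∣ s → q ⊢ e ⇓ f ∣ t →
                 p ⨾ q ⊢ d ⇓ f ∣ suc (s ℕ.+ t)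
    cond-true  : ∀ {c p q d b e s t} → c ⊢ d ⇓ b ∣ s → ¬ b ≡ nil → p ⊢ d ⇓ e ∣ t →
                 cond c p q ⊢ d ⇓ e ∣ suc (s ℕ.+ t)
    cond-false : ∀ {c p q d e s t} → c ⊢ d ⇓ nil ∣ s → q ⊢ d ⇓ e ∣ t →
                 cond c p q ⊢ d ⇓ e ∣ suc (s ℕ.+ t)
    while-stop : ∀ {c p d s} → c ⊢ d ⇓ nil ∣ s →
                 while c p ⊢ d ⇓ d ∣ suc s
    while-step : ∀ {c p d b e f s t r} → c ⊢ d ⇓ b ∣ s → ¬ b ≡ nil → p ⊢ d ⇓ e ∣ t →
                 while c p ⊢ e ⇓ f ∣ r →
                 while c p ⊢ d ⇓ f ∣ suc (s ℕ.+ t ℕ.+ r)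
    zero       : ∀ {d} → `0 ⊢ d ⇓ num 0# ∣ 1
    one        : ∀ {d} → `1 ⊢ d ⇓ num 1# ∣ 1
    add        : ∀ {x y} → `+ ⊢ num x ∷ num y ⇓ num (x + y) ∣ 1
    sub        : ∀ {x y} → `- ⊢ num x ∷ num y ⇓ num (x - y) ∣ 1
    mul        : ∀ {x y} → `* ⊢ num x ∷ num y ⇓ num (x * y) ∣ 1
    div        : ∀ {x y} → ¬ y ≈ 0# → `/ ⊢ num x ∷ num y ⇓ num (x * y ⁻¹) ∣ 1
    less-true  : ∀ {x y} → x < y → `< ⊢ num x ∷ num y ⇓ nil ∷ nil ∣ 1
    less-false : ∀ {x y} → ¬ x < y → `< ⊢ num x ∷ num y ⇓ nil ∣ 1

  ----------------------------------------------------------------------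
  -- Encodings

  list : ∀ {n} → (Fin n → Data) → Data
  list = Vector.foldr _∷_ nil

  encodePoint : Point → Data
  encodePoint (x , y) = num x ∷ num y

  encodePositions : ∀ {n} → (Fin n → Point) → Data
  encodePositions pos = list (encodePoint ∘ pos)

  encodeGraph : ∀ {n} → Graph n → Data
  encodeGraph G = list λ u → list λ v → if Graph.adj G u v then nil ∷ nil else nil

  encodeInstance : ∀ {n} → Instance n → Data
  encodeInstance I = boxes ∷ edges
    where
    open Instance I
    boxes = list λ v → num (w v) ∷ num (h v)
    edges = list λ u → list λ v → if adj u v then num (profit u v) else nil

  ----------------------------------------------------------------------
  -- Approximation algorithms

  -- An input may carry more than the instance itself, so each problem fixes its
  -- own encoding.
  record Problem : Set₁ where
    field
      Input    : Set
      vertices : Input → ℕ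
      instanceOf : (x : Input) → Instance (vertices x)
      encode   : Input → Data

  -- m * α ⁻¹ is OPT / α.  Since sizes are at least 1, bounds of the form
  -- a · size ^ b are as general as arbitrary polynomials.
  _AdmitsApproximation_ : Problem → Carrier → Set
  P AdmitsApproximation α =
    Σ[ A ∈ Prog ] ∃[ a ] ∃[ b ] (∀ (x : Input) →
      let open Instance (instanceOf x) in
      ∃[ pos ] ∃[ t ]
        (A ⊢ encode x ⇓ encodePositions pos ∣ t) ×
        (t ℕ.≤ a ℕ.* size (encode x) ℕ.^ b) ×
        IsRepresentation pos ×
        (∀ m → IsOPT m → m * α ⁻¹ ≤ totalProfit pos))
    where open Problem P

  MaxCrownOn : GraphClass → Problem
  MaxCrownOn 𝒢 = record
    { Input     = ∃[ n ] Σ[ I ∈ Instance n ] 𝒢 (Instance.graph I)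
    ; vertices  = proj₁
    ; instanceOf = λ (_ , I , _) → I
    ; encode    = λ (_ , I , _) → encodeInstance I
    }

  record CoveredInstance {k : ℕ} (𝒢 : Fin k → GraphClass) : Set where
    field
      {n}     : ℕ
      inst    : Instance n
      cover   : Fin k → Graph n
      member  : ∀ i → 𝒢 i (cover i)
      covers  : cover Covers Instance.graph inst

  MaxCrownOnCovered : ∀ {k} → (Fin k → GraphClass) → Problem
  MaxCrownOnCovered 𝒢 = record
    { Input     = CoveredInstance 𝒢
    ; vertices  = λ _ → _
    ; instanceOf = inst
    ; encode    = λ x → encodeInstance (inst x) ∷ list (encodeGraph ∘ cover x)
    }
    where open CoveredInstance

{-# OPTIONS --safe #-}
module Submission where

open import Defs
open import Algebra.Bundles using (CommutativeRing)
open import Data.Bool.Base using (Bool; true; false; if_then_else_; _∧_; _∨_; T)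
open import Data.Bool.Properties using (∧-zeroʳ)
open import Data.Fin.Base using (Fin; zero; suc)
import Data.Fin.Properties as Fin
open import Data.List.Base using (List; []; _∷_; cartesianProductWith)
open import Data.List.Relation.Unary.Any using (Any; here; there)
open import Data.List.Relation.Unary.Any.Properties using (cartesianProductWith⁺)
open import Data.Nat.Base as ℕ using (ℕ; zero; suc; NonZero; z≤n; s≤s)
import Data.Nat.Properties as ℕ
open import Data.Nat.Solver using (module +-*-Solver)
open import Data.Product.Base
  using (Σ; Σ-syntax; ∃; ∃-syntax; _×_; _,_; proj₁; proj₂)
open import Data.Sum.Base using (inj₁; inj₂)
open import Data.Unit.Base using (tt)
import Data.Vec.Functional as Vector
open import Function.Base using (_∘_)
open import Function.Bundles using (Equivalence; mk⇔)
open import Relation.Binary.Bundles using (TotalOrder)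
open import Relation.Binary.Definitions using (tri<; tri≈; tri>)
open import Relation.Binary.PropositionalEquality as ≡ using (_≡_; cong; subst)
open import Relation.Binary.Structures using (IsStrictTotalOrder)
open import Relation.Nullary.Decidable
  using ( Dec; does; yes; no; ⌊_⌋; isYes≗does; does-⇔; dec-true; dec-false
        ; decidable-stable; ¬¬-excluded-middle)
open import Relation.Nullary.Negation using (¬_; contradiction)

-- Run the i-th algorithm on the instance restricted to Gᵢ for every i, evaluate
-- the resulting representations on G, and keep the best one, of profit B say.
-- A representation λ of G realizes each of its edges in some Gᵢ, so its profit
-- is at most the sum of its profits on the Gᵢ, and the i-th of these is at most
-- OPT(Gᵢ) ≤ αᵢ B.  The existence of OPT(Gᵢ) is only available up to double
-- negation, which suffices because ≤ on the reals is decidable.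

-- Two obstacles shape the proof. The ratio is stated against an optimum, so it says nothing until
-- one exists; each pair of vertices contributes its profit or `0#`, hence the objective has
-- finitely many values and classically a maximum is reached. Moreover, running times have to
-- survive composition: all of them are measured in the size of the original input, and the only
-- intermediate datum whose size matters is the restricted instance handed to a given algorithm. The
-- added loops run over the vertices only.

-- Programs of the combined algorithm.

loop fold : Prog → Prog
loop p = while tl ⟨ ⟨ hd , tl ⨾ hd ⟩ ⨾ p , tl ⨾ tl ⟩
fold p = loop p ⨾ hd

reverseᴾ sumᴾ : Prog
reverseᴾ = ⟨ nil , id ⟩ ⨾ fold ⟨ tl , hd ⟩
sumᴾ = ⟨ `0 , id ⟩ ⨾ fold `+

-- On c ∷ (xs ∷ ys): the accumulator c ∷ (ys′ ∷ out) of the fold over xs holds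
-- the remaining part of ys and the results so far in reverse order.
zipStep zipᴾ : Prog → Prog
zipStep p = ⟨ hd ⨾ hd ,
            ⟨ hd ⨾ (tl ⨾ (hd ⨾ tl)) ,
            ⟨ ⟨ hd ⨾ hd , ⟨ tl , hd ⨾ (tl ⨾ (hd ⨾ hd)) ⟩ ⟩ ⨾ p , hd ⨾ (tl ⨾ tl) ⟩ ⟩ ⟩
zipᴾ p = ⟨ ⟨ hd , ⟨ tl ⨾ tl , nil ⟩ ⟩ , tl ⨾ hd ⟩ ⨾ (fold (zipStep p) ⨾ ((tl ⨾ tl) ⨾ reverseᴾ))

-- The index belongs to the program, not to its input: `k` is fixed, so reaching a covering graph
-- takes constant time.
nthᴾ : ∀ {k} → Fin k → Prog
nthᴾ zero    = hd
nthᴾ (suc i) = tl ⨾ nthᴾ i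

loopFree : Prog → Bool
loopFree ⟨ p , q ⟩    = loopFree p ∧ loopFree q
loopFree (p ⨾ q)      = loopFree p ∧ loopFree q
loopFree (cond c p q) = loopFree c ∧ (loopFree p ∧ loopFree q)
loopFree (while _ _)  = false
loopFree _            = true

-- Both branches of a conditional are charged, so that the bound depends on the program alone. The
-- value at `while` is junk: only loop-free programs are measured this way.
cost : Prog → ℕ
cost ⟨ p , q ⟩    = suc (cost p ℕ.+ cost q)
cost (p ⨾ q)      = suc (cost p ℕ.+ cost q)
cost (cond c p q) = suc (cost c ℕ.+ (cost p ℕ.+ cost q))
cost _            = 1

∧-T : ∀ a {b} → T (a ∧ b) → T a × T b
∧-T true t = tt , t

maxᴾ minᴾ ≤ᴾ overlapᴾ xᴾ yᴾ contactᴾ : Prog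
maxᴾ = cond `< tl hd
minᴾ = cond (⟨ tl , hd ⟩ ⨾ `<) tl hd
≤ᴾ   = cond (⟨ tl , hd ⟩ ⨾ `<) nil ⟨ nil , nil ⟩

andᴾ orᴾ : Prog → Prog → Prog
andᴾ p q = cond p q nil
orᴾ  p q = cond p ⟨ nil , nil ⟩ q

-- Intervals are given by left end and length.
overlapᴾ = ⟨ ⟨ hd ⨾ hd , tl ⨾ hd ⟩ ⨾ maxᴾ , ⟨ hd ⨾ `+ , tl ⨾ `+ ⟩ ⨾ minᴾ ⟩
xᴾ = ⟨ hd ⨾ hd , tl ⨾ hd ⟩
yᴾ = ⟨ hd ⨾ tl , tl ⨾ tl ⟩
contactᴾ = ⟨ ⟨ hd ⨾ xᴾ , tl ⨾ xᴾ ⟩ ⨾ overlapᴾ , ⟨ hd ⨾ yᴾ , tl ⨾ yᴾ ⟩ ⨾ overlapᴾ ⟩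
         ⨾ andᴾ (hd ⨾ ≤ᴾ) (andᴾ (tl ⨾ ≤ᴾ) (orᴾ (hd ⨾ `<) (tl ⨾ `<)))

-- The score sums over ordered pairs of vertices, so it counts every edge twice;
-- this avoids comparing indices and does not affect which score is larger.
entryᴾ rowᴾ scoreᴾ : Prog
entryᴾ = cond (tl ⨾ tl) (cond (⟨ hd , tl ⨾ hd ⟩ ⨾ contactᴾ) (tl ⨾ tl) `0) `0
rowᴾ   = ⟨ tl ⨾ hd , ⟨ hd , tl ⨾ tl ⟩ ⟩ ⨾ (zipᴾ entryᴾ ⨾ sumᴾ)
scoreᴾ = ⟨ ⟨ nil , ⟨ tl , hd ⨾ hd ⟩ ⟩ ⨾ zipᴾ tl , hd ⨾ tl ⟩ ⨾ (⟨ hd , id ⟩ ⨾ (zipᴾ rowᴾ ⨾ sumᴾ))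

-- A deleted entry becomes `nil`, the code of a non-edge, so the result again encodes an instance.
-- The `nil` in front fills the context slot of `zipᴾ`.
maskᴾ restrictᴾ : Prog
maskᴾ     = cond (tl ⨾ tl) (tl ⨾ hd) nil
restrictᴾ = ⟨ nil , id ⟩ ⨾ zipᴾ (⟨ nil , tl ⟩ ⨾ zipᴾ maskᴾ)

-- The input is kept beside both outputs because scoring needs the instance; `hd ⨾ hd` extracts it,
-- so profits count on the whole graph. Ties go to `p`.
selectᴾ : Prog → Prog → Prog
selectᴾ p q = ⟨ id , ⟨ p , q ⟩ ⟩
            ⨾ cond (⟨ ⟨ hd ⨾ hd , tl ⨾ hd ⟩ ⨾ scoreᴾ , ⟨ hd ⨾ hd , tl ⨾ tl ⟩ ⨾ scoreᴾ ⟩ ⨾ `<)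
                   (tl ⨾ tl) (tl ⨾ hd)

restrictToᴾ : ∀ {k} → Fin k → Prog
restrictToᴾ i = ⟨ hd ⨾ hd , ⟨ hd ⨾ tl , tl ⨾ nthᴾ i ⟩ ⨾ restrictᴾ ⟩

-- Evaluation and running times of the programs.

module Execution (R : RealNumbers) where

  open ≡ using (refl; sym; trans)
  open RealNumbers R
  open MaxCrown R
  open IsStrictTotalOrder isStrictTotalOrder using (compare) renaming (_<?_ to _<ᵣ?_)
  open import Algebra.Construct.NaturalChoice.Max totalOrder using (_⊔_)
  open import Algebra.Construct.NaturalChoice.Min totalOrder using (_⊓_)
  import Relation.Binary.Construct.StrictToNonStrict _≈_ _<_ as NonStrict

  private variable
    p q c f : Prog
    d e : Data
    n k : ℕ

  infix 4 _⊢_↦_ _⊢_↦_within_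

  _⊢_↦_ : Prog → Data → Data → Set
  p ⊢ d ↦ e = ∃[ t ] (p ⊢ d ⇓ e ∣ t)

  _⊢_↦_within_ : Prog → Data → Data → ℕ → Set
  p ⊢ d ↦ e within b = ∃[ t ] (p ⊢ d ⇓ e ∣ t) × t ℕ.≤ b

  cost-bound : ∀ {t} → T (loopFree p) → p ⊢ d ⇓ e ∣ t → t ℕ.≤ cost p
  cost-bound lf id  = ℕ.≤-refl
  cost-bound lf nil = ℕ.≤-refl
  cost-bound lf hd  = ℕ.≤-refl
  cost-bound lf tl  = ℕ.≤-refl
  cost-bound {p = ⟨ p , q ⟩} lf (pair D E) = let lp , lq = ∧-T (loopFree p) lf in
    s≤s (ℕ.+-mono-≤ (cost-bound lp D) (cost-bound lq E))
  cost-bound {p = p ⨾ q} lf (seq D E) = let lp , lq = ∧-T (loopFree p) lf in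
    s≤s (ℕ.+-mono-≤ (cost-bound lp D) (cost-bound lq E))
  cost-bound {p = cond c p q} lf (cond-true C _ D) =
    let lc , lpq = ∧-T (loopFree c) lf ; lp , _ = ∧-T (loopFree p) lpq in
    s≤s (ℕ.+-mono-≤ (cost-bound lc C) (ℕ.≤-trans (cost-bound lp D) (ℕ.m≤m+n _ _)))
  cost-bound {p = cond c p q} lf (cond-false C D) =
    let lc , lpq = ∧-T (loopFree c) lf ; _ , lq = ∧-T (loopFree p) lpq in
    s≤s (ℕ.+-mono-≤ (cost-bound lc C) (ℕ.≤-trans (cost-bound lq D) (ℕ.m≤n+m _ (cost p))))
  cost-bound lf zero = ℕ.≤-refl
  cost-bound lf one  = ℕ.≤-refl
  cost-bound lf add  = ℕ.≤-refl
  cost-bound lf sub  = ℕ.≤-refl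
  cost-bound lf mul  = ℕ.≤-refl
  cost-bound lf (div _)        = ℕ.≤-refl
  cost-bound lf (less-true _)  = ℕ.≤-refl
  cost-bound lf (less-false _) = ℕ.≤-refl

  -- Loops

  -- Besides the body, a pass spends 12 steps on the test, on rearranging the state and on the
  -- `while` rule; the final 2 pay for the test that finds `nil`.
  loopTime : ℕ → ℕ → ℕ
  loopTime b n = n ℕ.* (b ℕ.+ 12) ℕ.+ 2

  loop-nil : loop f ⊢ d ∷ nil ↦ d ∷ nil within loopTime k 0
  loop-nil = _ , while-stop tl , ℕ.≤-refl

  loop-cons : ∀ {acc acc′ x xs r} →
              f ⊢ acc ∷ x ↦ acc′ within k → loop f ⊢ acc′ ∷ xs ↦ r within loopTime k n →
              loop f ⊢ acc ∷ (x ∷ xs) ↦ r within loopTime k (suc n)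
  loop-cons {k = k} {n = n} (t , D , t≤k) (s , E , s≤) =
    _ , while-step tl (λ ()) (pair (seq (pair hd (seq tl hd)) D) (seq tl tl)) E ,
    ℕ.≤-trans (ℕ.+-monoʳ-≤ 9 (ℕ.+-mono-≤ (ℕ.+-monoˡ-≤ 3 t≤k) s≤))
      (ℕ.≤-reflexive (solve 2 (λ b m → con 9 :+ ((b :+ con 3) :+ (m :* (b :+ con 12) :+ con 2))
                                    := (con 1 :+ m) :* (b :+ con 12) :+ con 2) refl k n))
    where open +-*-Solver

  fold-runs : ∀ {acc acc′ xs} → loop f ⊢ acc ∷ xs ↦ acc′ ∷ nil within k →
              fold f ⊢ acc ∷ xs ↦ acc′ within suc (k ℕ.+ 1)
  fold-runs (_ , D , t≤k) = _ , seq D hd , s≤s (ℕ.+-monoˡ-≤ 1 t≤k)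

  -- As a left fold it unfolds, by computation, in step with the accumulator of the loop.
  reversed : (Fin n → Data) → Data → Data
  reversed x acc = Vector.foldl (λ xs y → y ∷ xs) acc x

  -- The induction peels `x` from the front, but the loop meets those entries last. Therefore the
  -- remaining run is a hypothesis, to which each peeled entry prepends one pass.
  reverse-loop : ∀ (x : Fin n → Data) acc {rest r m} →
    loop ⟨ tl , hd ⟩ ⊢ Vector.foldr _∷_ acc x ∷ rest ↦ r within loopTime 3 m →
    loop ⟨ tl , hd ⟩ ⊢ acc ∷ reversed x rest ↦ r within loopTime 3 (n ℕ.+ m)
  reverse-loop {zero}  x acc E = E
  reverse-loop {suc n} x acc {rest} {r} {m} E =
    subst (λ j → loop ⟨ tl , hd ⟩ ⊢ acc ∷ reversed x rest ↦ r within loopTime 3 j) (ℕ.+-suc n m)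
      (reverse-loop (x ∘ suc) acc (loop-cons {n = m} (_ , pair tl hd , ℕ.≤-refl) E))

  reverse-time : ℕ → ℕ
  reverse-time n = suc (3 ℕ.+ suc (loopTime 3 (n ℕ.+ 0) ℕ.+ 1))

  reverse-runs : (x : Fin n → Data) →
    reverseᴾ ⊢ reversed x nil ↦ list x within reverse-time n
  reverse-runs x with fold-runs (reverse-loop x nil (loop-nil {k = 3}))
  ... | _ , D , t≤ = _ , seq (pair nil id) D , s≤s (ℕ.+-monoʳ-≤ 3 t≤)

  -- In the bound, 5 is the cost of `hd ⨾ (tl ⨾ tl)`, evaluated after `g`, and 27 that of everything
  -- else; in this shape it matches the derivation by computation.
  zip-loop : ∀ {g} c (x y z : Fin n → Data) acc →
    (∀ i → g ⊢ c ∷ (x i ∷ y i) ↦ z i within k) →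
    loop (zipStep g) ⊢ (c ∷ (list y ∷ acc)) ∷ list x ↦
      (c ∷ (nil ∷ reversed z acc)) ∷ nil within loopTime (27 ℕ.+ (k ℕ.+ 5)) n
  zip-loop {zero}  {k} c x y z acc G = loop-nil {k = 27 ℕ.+ (k ℕ.+ 5)}
  zip-loop {suc n} {k} {g} c x y z acc G = loop-cons {n = n} (step (G zero))
    (zip-loop c (x ∘ suc) (y ∘ suc) (z ∘ suc) (z zero ∷ acc) (G ∘ suc))
    where
    step : ∀ {x y ys z} → g ⊢ c ∷ (x ∷ y) ↦ z within k →
           zipStep g ⊢ (c ∷ ((y ∷ ys) ∷ acc)) ∷ x ↦ c ∷ (ys ∷ (z ∷ acc)) within (27 ℕ.+ (k ℕ.+ 5))
    step (t , D , t≤k) =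
      _ , pair (seq hd hd) (pair (seq hd (seq tl (seq hd tl)))
            (pair (seq (pair (seq hd hd) (pair tl (seq hd (seq tl (seq hd hd))))) D)
                  (seq hd (seq tl tl)))) ,
      ℕ.+-monoʳ-≤ 27 (ℕ.+-monoˡ-≤ 5 t≤k)

  sum-loop : ∀ (x : Fin n → Carrier) a →
    loop `+ ⊢ num a ∷ list (num ∘ x) ↦ num (Vector.foldl _+_ a x) ∷ nil within loopTime 1 n
  sum-loop {zero}  x a = loop-nil {k = 1}
  sum-loop {suc n} x a = loop-cons {n = n} (_ , add , ℕ.≤-refl) (sum-loop (x ∘ suc) (a + x zero))

  -- Polynomial time on a family of inputs

  Poly : {X : Set} → (X → Data) → (X → ℕ) → Set
  Poly D t = ∃[ a ] ∃[ b ] (∀ x → t x ℕ.≤ a ℕ.* size (D x) ℕ.^ b)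

  size-nonZero : ∀ d → NonZero (size d)
  size-nonZero nil     = _
  size-nonZero (num _) = _
  size-nonZero (d ∷ e) = _

  module _ {X : Set} {D : X → Data} where

    Poly-≤ : ∀ {s t : X → ℕ} → (∀ x → s x ℕ.≤ t x) → Poly D t → Poly D s
    Poly-≤ s≤t (a , b , t≤) = a , b , λ x → ℕ.≤-trans (s≤t x) (t≤ x)

    Poly-const : ∀ c → Poly D (λ _ → c)
    Poly-const c = c , 0 , λ x → ℕ.≤-reflexive (sym (ℕ.*-identityʳ c))

    Poly-size : Poly D (size ∘ D)
    Poly-size = 1 , 1 , λ x → ℕ.≤-reflexive
      (sym (trans (ℕ.*-identityˡ _) (ℕ.*-identityʳ (size (D x)))))

    -- Both bounds are raised to the exponent `b ℕ.+ d`, which is sound because sizes are at least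
    -- 1.
    Poly-+ : ∀ {s t : X → ℕ} → Poly D s → Poly D t → Poly D (λ x → s x ℕ.+ t x)
    Poly-+ (a , b , s≤) (c , d , t≤) = a ℕ.+ c , b ℕ.+ d , λ x →
      let instance _ = size-nonZero (D x) ; N = size (D x) in
      ℕ.≤-trans
        (ℕ.+-mono-≤ (ℕ.≤-trans (s≤ x) (ℕ.*-monoʳ-≤ a (ℕ.^-monoʳ-≤ N (ℕ.m≤m+n b d))))
                    (ℕ.≤-trans (t≤ x) (ℕ.*-monoʳ-≤ c (ℕ.^-monoʳ-≤ N (ℕ.m≤n+m d b)))))
        (ℕ.≤-reflexive (sym (ℕ.*-distribʳ-+ (N ℕ.^ (b ℕ.+ d)) a c)))

    Poly-* : ∀ {s t : X → ℕ} → Poly D s → Poly D t → Poly D (λ x → s x ℕ.* t x)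
    Poly-* (a , b , s≤) (c , d , t≤) = a ℕ.* c , b ℕ.+ d , λ x →
      let N = size (D x) in
      ℕ.≤-trans (ℕ.*-mono-≤ (s≤ x) (t≤ x)) (ℕ.≤-reflexive
        (trans (solve 4 (λ a p c q → (a :* p) :* (c :* q) := (a :* c) :* (p :* q)) refl
                 a (N ℕ.^ b) c (N ℕ.^ d))
               (cong (a ℕ.* c ℕ.*_) (sym (ℕ.^-distribˡ-+-* N b d)))))
      where open +-*-Solver

    Poly-loopTime : ∀ {s t : X → ℕ} → Poly D s → Poly D t → Poly D (λ x → loopTime (s x) (t x))
    Poly-loopTime s t = Poly-+ (Poly-* t (Poly-+ s (Poly-const 12))) (Poly-const 2)

  -- D is the input in whose size the running time is measured; it may differ
  -- from the argument f x on which p is run.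
  record PolyTime {X : Set} (D : X → Data) (p : Prog) (f g : X → Data) : Set where
    constructor polyTime
    field
      {time}  : X → ℕ
      isPoly  : Poly D time
      runs    : ∀ x → p ⊢ f x ↦ g x within time x

  open PolyTime

  module _ {X : Set} {D : X → Data} where

    -- For a concrete program the implicit argument computes to the unit type and is inferred, so
    -- that only an evaluation has to be given.
    loopFree⇒PolyTime : ∀ {p} {f g : X → Data} {_ : T (loopFree p)} →
                        (∀ x → p ⊢ f x ↦ g x) → PolyTime D p f g
    loopFree⇒PolyTime {p} {_} {_} {lf} run = polyTime (Poly-const (cost p))
      λ x → _ , proj₂ (run x) , cost-bound lf (proj₂ (run x))

    ⨾-PolyTime : ∀ {p q} {f g h : X → Data} →
                 PolyTime D p f g → PolyTime D q g h → PolyTime D (p ⨾ q) f h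
    ⨾-PolyTime P Q = polyTime (Poly-+ (Poly-const 1) (Poly-+ (isPoly P) (isPoly Q))) λ x →
      let _ , E , s≤ = runs P x ; _ , F , t≤ = runs Q x in _ , seq E F , s≤s (ℕ.+-mono-≤ s≤ t≤)

    pair-PolyTime : ∀ {p q} {f g h : X → Data} →
                    PolyTime D p f g → PolyTime D q f h → PolyTime D ⟨ p , q ⟩ f (λ x → g x ∷ h x)
    pair-PolyTime P Q = polyTime (Poly-+ (Poly-const 1) (Poly-+ (isPoly P) (isPoly Q))) λ x →
      let _ , E , s≤ = runs P x ; _ , F , t≤ = runs Q x in _ , pair E F , s≤s (ℕ.+-mono-≤ s≤ t≤)

    -- Indexing the body by pairs `(x , i)`, but measuring it in `D x`, gives one polynomial for all
    -- entries; multiplied by the length it bounds the loop. The same device lets zips nest.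
    zip-PolyTime : ∀ {n : X → ℕ} (n≤ : ∀ x → n x ℕ.≤ size (D x)) {g}
      (c : X → Data) (y z r : ∀ x → Fin (n x) → Data) →
      PolyTime {Σ X (Fin ∘ n)} (D ∘ proj₁) g
        (λ (x , i) → c x ∷ (y x i ∷ z x i)) (λ (x , i) → r x i) →
      PolyTime D (zipᴾ g) (λ x → c x ∷ (list (y x) ∷ list (z x))) (λ x → list (r x))
    zip-PolyTime {n} n≤ {g} c y z r (polyTime (a , b , t≤) G) = polyTime
      (Poly-+ (Poly-const 12)
        (Poly-+ (Poly-const 1)
          (Poly-+ (Poly-+ (Poly-const 1)
                    (Poly-+ (Poly-loopTime (Poly-+ (Poly-const 27) (Poly-+ G-poly (Poly-const 5))) n-poly)
                            (Poly-const 1)))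
                  (Poly-+ (Poly-const 4)
                    (Poly-+ (Poly-const 5)
                            (Poly-+ (Poly-loopTime (Poly-const 3) (Poly-+ n-poly (Poly-const 0)))
                                    (Poly-const 1)))))))
      λ x →
        let _ , E , s≤ = fold-runs (zip-loop (c x) (y x) (z x) (r x) nil
              λ i → let u , F , u≤ = G (x , i) in u , F , ℕ.≤-trans u≤ (t≤ (x , i)))
            _ , E′ , s′≤ = reverse-runs (r x)
        in _ , seq (pair (pair hd (pair (seq tl tl) nil)) (seq tl hd))
                 (seq E (seq (seq tl tl) E′)) ,
           ℕ.+-monoʳ-≤ 13 (ℕ.+-mono-≤ s≤ (ℕ.+-monoʳ-≤ 4 s′≤))
      where
      n-poly = Poly-≤ n≤ Poly-size
      G-poly : Poly D (λ x → a ℕ.* size (D x) ℕ.^ b)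
      G-poly = a , b , λ x → ℕ.≤-refl

    sum-PolyTime : ∀ {n : X → ℕ} (n≤ : ∀ x → n x ℕ.≤ size (D x)) (y : ∀ x → Fin (n x) → Carrier) →
      PolyTime D sumᴾ (λ x → list (num ∘ y x)) (λ x → num (Vector.foldl _+_ 0# (y x)))
    sum-PolyTime n≤ y = polyTime
      (Poly-+ (Poly-const 5)
        (Poly-+ (Poly-loopTime (Poly-const 1) (Poly-≤ n≤ Poly-size)) (Poly-const 1)))
      λ x → let _ , E , s≤ = fold-runs (sum-loop (y x) 0#) in
        _ , seq (pair zero id) E , ℕ.+-monoʳ-≤ 4 s≤

  nth-runs : ∀ (x : Fin k → Data) i → nthᴾ i ⊢ list x ↦ x i
  nth-runs x zero    = _ , hd
  nth-runs x (suc i) = _ , seq tl (proj₂ (nth-runs (x ∘ suc) i))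

  nth-loopFree : (i : Fin k) → T (loopFree (nthᴾ i))
  nth-loopFree zero    = tt
  nth-loopFree (suc i) = nth-loopFree i

  -- Contact of boxes

  bool : Bool → Data
  bool b = if b then nil ∷ nil else nil

  ⨾-↦ : ∀ {h} → p ⊢ d ↦ e → q ⊢ e ↦ h → p ⨾ q ⊢ d ↦ h
  ⨾-↦ (_ , D) (_ , E) = _ , seq D E

  pair-↦ : ∀ {h} → p ⊢ d ↦ e → q ⊢ d ↦ h → ⟨ p , q ⟩ ⊢ d ↦ e ∷ h
  pair-↦ (_ , D) (_ , E) = _ , pair D E

  if-↦ : ∀ {A : Set} (enc : A → Data) {b x y} → c ⊢ d ↦ bool b → p ⊢ d ↦ enc x → q ⊢ d ↦ enc y →
         cond c p q ⊢ d ↦ enc (if b then x else y)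
  if-↦ _ {b = true}  (_ , C) (_ , D) _ = _ , cond-true C (λ ()) D
  if-↦ _ {b = false} (_ , C) _ (_ , D) = _ , cond-false C D

  and-↦ : ∀ {a b} → p ⊢ d ↦ bool a → q ⊢ d ↦ bool b → andᴾ p q ⊢ d ↦ bool (a ∧ b)
  and-↦ {a = true}  (_ , D) (_ , E) = _ , cond-true D (λ ()) E
  and-↦ {a = false} (_ , D) _       = _ , cond-false D nil

  or-↦ : ∀ {a b} → p ⊢ d ↦ bool a → q ⊢ d ↦ bool b → orᴾ p q ⊢ d ↦ bool (a ∨ b)
  or-↦ {a = true}  (_ , D) _       = _ , cond-true D (λ ()) (pair nil nil)
  or-↦ {a = false} (_ , D) (_ , E) = _ , cond-false D E

  -- `_⊔_` decides by `compare y x`. A tie must be broken as it does there, since results are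
  -- compared by `_≡_` and not by `_≈_`.
  max-runs : ∀ x y → maxᴾ ⊢ num x ∷ num y ↦ num (x ⊔ y)
  max-runs x y with compare y x
  ... | tri< _ _ x≮y = _ , cond-false (less-false x≮y) hd
  ... | tri≈ _ _ x≮y = _ , cond-false (less-false x≮y) hd
  ... | tri> _ _ x<y = _ , cond-true (less-true x<y) (λ ()) tl

  min-runs : ∀ x y → minᴾ ⊢ num x ∷ num y ↦ num (x ⊓ y)
  min-runs x y with compare x y
  ... | tri< _ _ y≮x = _ , cond-false (seq (pair tl hd) (less-false y≮x)) hd
  ... | tri≈ _ _ y≮x = _ , cond-false (seq (pair tl hd) (less-false y≮x)) hd
  ... | tri> _ _ y<x = _ , cond-true (seq (pair tl hd) (less-true y<x)) (λ ()) tl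

  ≤-runs : ∀ x y → ≤ᴾ ⊢ num x ∷ num y ↦ bool (does (NonStrict.decidable′ compare x y))
  ≤-runs x y with compare x y
  ... | tri< _ _ y≮x = _ , cond-false (seq (pair tl hd) (less-false y≮x)) (pair nil nil)
  ... | tri≈ _ _ y≮x = _ , cond-false (seq (pair tl hd) (less-false y≮x)) (pair nil nil)
  ... | tri> _ _ y<x = _ , cond-true (seq (pair tl hd) (less-true y<x)) (λ ()) nil

  <-runs : ∀ x y → `< ⊢ num x ∷ num y ↦ bool (does (x <ᵣ? y))
  <-runs x y with compare x y
  ... | tri< x<y _ _ = _ , less-true x<y
  ... | tri≈ x≮y _ _ = _ , less-false x≮y
  ... | tri> x≮y _ _ = _ , less-false x≮y

  overlap-runs : ∀ a w a′ w′ → overlapᴾ ⊢ (num a ∷ num w) ∷ (num a′ ∷ num w′) ↦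
                 num (a ⊔ a′) ∷ num ((a + w) ⊓ (a′ + w′))
  overlap-runs a w a′ w′ = pair-↦
    (⨾-↦ (_ , pair (seq hd hd) (seq tl hd)) (max-runs a a′))
    (⨾-↦ (_ , pair (seq hd add) (seq tl add)) (min-runs (a + w) (a′ + w′)))

  encodeBox : Box → Data
  encodeBox (box q w h) = encodePoint q ∷ (num w ∷ num h)

  -- Opaque, since comparing sums over unfolded contact tests explodes.
  opaque
    touch : Box → Box → Bool
    touch B B′ = ⌊ contact? B B′ ⌋

    contact-runs : ∀ B B′ → contactᴾ ⊢ encodeBox B ∷ encodeBox B′ ↦ bool (touch B B′)
    contact-runs (box (a , b) w h) (box (a′ , b′) w′ h′) = subst (λ b → contactᴾ ⊢ _ ↦ bool b)
      -- `does` unfolds through `map′`, `_×-dec_` and `_⊎-dec_` to the very connectives that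
      -- `contactᴾ` evaluates, whereas `⌊_⌋` is stuck.
      (sym (isYes≗does (contact? (box (a , b) w h) (box (a′ , b′) w′ h′)))) (⨾-↦
      (pair-↦
        (⨾-↦ (_ , pair (seq hd (pair (seq hd hd) (seq tl hd))) (seq tl (pair (seq hd hd) (seq tl hd))))
             (overlap-runs a w a′ w′))
        (⨾-↦ (_ , pair (seq hd (pair (seq hd tl) (seq tl tl))) (seq tl (pair (seq hd tl) (seq tl tl))))
             (overlap-runs b h b′ h′)))
      (and-↦ (⨾-↦ (_ , hd) (≤-runs _ _))
        (and-↦ (⨾-↦ (_ , tl) (≤-runs _ _))
          (or-↦ (⨾-↦ (_ , hd) (<-runs _ _)) (⨾-↦ (_ , tl) (<-runs _ _))))))

    touch-sym : ∀ B B′ → touch B B′ ≡ touch B′ B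
    touch-sym B B′ = trans (isYes≗does (contact? B B′))
      (trans (does-⇔ (mk⇔ (swap B B′) (swap B′ B)) (contact? B B′) (contact? B′ B)) (sym (isYes≗does (contact? B′ B))))
      where
      swap : ∀ B B′ → Contact B B′ → Contact B′ B
      swap _ _ (a , b , a≉b , inside) = a , b , a≉b , λ t 0≤t t≤1 → let p , q = inside t 0≤t t≤1 in q , p

    totalProfit-touch : (I : Instance n) → let open Instance I in ∀ pos →
      totalProfit pos ≡ ∑[ u < n ] ∑[ v < n ]
        (if ⌊ u Fin.<? v ⌋ ∧ adj u v ∧ touch (place pos u) (place pos v) then profit u v else 0#)
    totalProfit-touch I pos = refl

  list-size-mono : ∀ {x y : Fin n → Data} → (∀ i → size (x i) ℕ.≤ size (y i)) →
                   size (list x) ℕ.≤ size (list y)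
  list-size-mono {zero}  x≤y = ℕ.≤-refl
  list-size-mono {suc n} x≤y = s≤s (ℕ.+-mono-≤ (x≤y zero) (list-size-mono (x≤y ∘ suc)))

  length≤size : (x : Fin n → Data) → n ℕ.≤ size (list x)
  length≤size {zero}  x = z≤n
  length≤size {suc n} x = s≤s (ℕ.≤-trans (length≤size (x ∘ suc)) (ℕ.m≤n+m _ (size (x zero))))

  -- Scores of representations

  -- The conditionals are nested in the order in which `entryᴾ` branches.
  gain : Instance n → (Fin n → Point) → Fin n → Fin n → Carrier
  gain I pos u v = if adj u v then (if touch (place pos u) (place pos v) then profit u v else 0#) else 0#
    where open Instance I

  -- These left folds are the exact terms that `sumᴾ` outputs; reassociating them would hold only up
  -- to `_≈_`.
  score : Instance n → (Fin n → Point) → Carrier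
  score I pos = Vector.foldl _+_ 0# λ u → Vector.foldl _+_ 0# (gain I pos u)

  entry-runs : ∀ (I : Instance n) pos u v → let open Instance I in
    entryᴾ ⊢ encodeBox (place pos u) ∷ (encodeBox (place pos v) ∷ (if adj u v then num (profit u v) else nil))
      ↦ num (gain I pos u v)
  entry-runs I pos u v with Instance.adj I u v
  ... | false = _ , cond-false (seq tl tl) zero
  ... | true  = cond-true-↦ (_ , seq tl tl) (λ ()) (if-↦ num
    (⨾-↦ (_ , pair hd (seq tl hd)) (contact-runs (place pos u) (place pos v))) (_ , seq tl tl) (_ , zero))
    where
    open Instance I
    cond-true-↦ : ∀ {b} → c ⊢ d ↦ b → ¬ b ≡ nil → p ⊢ d ↦ e → cond c p q ⊢ d ↦ e
    cond-true-↦ (_ , C) b≢nil (_ , D) = _ , cond-true C b≢nil D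

  module _ {X : Set} {D : X → Data} {n : X → ℕ} (n≤ : ∀ x → n x ℕ.≤ size (D x)) where

    -- Zipping positions with dimensions yields `encodeBox`. The list of all boxes is then the
    -- shared context of the rows, and inside row `u` the box of `u` is the context.
    score-PolyTime : (I : ∀ x → Instance (n x)) (pos : ∀ x → Fin (n x) → Point) →
      PolyTime D scoreᴾ (λ x → encodeInstance (I x) ∷ encodePositions (pos x)) (λ x → num (score (I x) (pos x)))
    score-PolyTime I pos =
      ⨾-PolyTime
        (pair-PolyTime
          (⨾-PolyTime (loopFree⇒PolyTime λ x → _ , pair nil (pair tl (seq hd hd)))
            (zip-PolyTime n≤ _ _ _ _ (loopFree⇒PolyTime λ _ → _ , tl)))
          (loopFree⇒PolyTime λ x → _ , seq hd tl))
        (⨾-PolyTime (loopFree⇒PolyTime λ x → _ , pair hd id)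
          (⨾-PolyTime
            (zip-PolyTime n≤ (λ x → list (boxes x)) boxes edges
              (λ x u → num (Vector.foldl _+_ 0# (gain (I x) (pos x) u)))
              (⨾-PolyTime (loopFree⇒PolyTime λ x → _ , pair (seq tl hd) (pair hd (seq tl tl)))
                (⨾-PolyTime
                  (zip-PolyTime (n≤ ∘ proj₁) _ _ _ _
                    (loopFree⇒PolyTime λ ((x , u) , v) → entry-runs (I x) (pos x) u v))
                  (sum-PolyTime (n≤ ∘ proj₁) λ (x , u) → gain (I x) (pos x) u))))
            (sum-PolyTime n≤ λ x u → Vector.foldl _+_ 0# (gain (I x) (pos x) u))))
      where
      boxes = λ x v → encodeBox (Instance.place (I x) (pos x) v)
      edges = λ x u → list λ v → if Instance.adj (I x) u v then num (Instance.profit (I x) u v) else nil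

-- Objective values and optima.

module Bounds (R : RealNumbers) where

  open RealNumbers R
  open RealProperties R using (+-mono-≤; *-monoˡ-≤; cancel)
  open MaxCrown R
  open Execution R using (gain; score; touch; touch-sym; totalProfit-touch)
  open CommutativeRing commutativeRing
    using ( refl; sym; trans; +-comm; +-assoc; +-identityˡ; +-identityʳ; +-cong; +-congˡ
          ; *-congˡ; *-comm; *-assoc; *-identityˡ; distribˡ; -‿inverseʳ; semiring)
  open IsStrictTotalOrder isStrictTotalOrder using (compare; irrefl; <-resp-≈) renaming (trans to <-trans)
  open TotalOrder totalOrder using (≤-respˡ-≈; ≤-respʳ-≈)
    renaming (trans to ≤-trans; refl to ≤-refl)
  open import Algebra.Properties.Semiring.Sum semiring
    using (sum; sum-cong-≋; ∑-distrib-+; ∑-comm)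
  import Relation.Binary.Construct.StrictToNonStrict _≈_ _<_ as NonStrict

  private variable
    n k : ℕ
    X : Set

  -- Order and sums

  _≤?_ : ∀ x y → Dec (x ≤ y)
  _≤?_ = NonStrict.decidable′ compare

  ≮⇒≥ : ∀ {x y} → ¬ x < y → y ≤ x
  ≮⇒≥ {x} {y} x≮y with compare x y
  ... | tri< x<y _ _ = contradiction x<y x≮y
  ... | tri≈ _ x≈y _ = inj₂ (sym x≈y)
  ... | tri> _ _ y<x = inj₁ y<x

  <⇒≱ : ∀ {x y} → x < y → ¬ y ≤ x
  <⇒≱ x<y (inj₁ y<x) = irrefl refl (<-trans x<y y<x)
  <⇒≱ x<y (inj₂ y≈x) = irrefl (sym y≈x) x<y

  +-mono-< : ∀ {x y z w} → x < y → z < w → x + z < y + w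
  +-mono-< {x} {y} {z} {w} x<y z<w = <-trans (+-monoˡ-< z x<y)
    (proj₂ <-resp-≈ (+-comm z y) (proj₁ <-resp-≈ (+-comm w y) (+-monoˡ-< y z<w)))

  halve-≤ : ∀ {x y} → x + x ≤ y + y → x ≤ y
  halve-≤ 2x≤2y = ≮⇒≥ λ y<x → <⇒≱ (+-mono-< y<x y<x) 2x≤2y

  *-monoˡ-< : ∀ {c x y} → 0# < c → x < y → c * x < c * y
  *-monoˡ-< {c} {x} {y} 0<c x<y = proj₁ <-resp-≈ eq
    (proj₂ <-resp-≈ (+-identityˡ _) (+-monoˡ-< (c * x) (*-pos 0<c 0<y-x)))
    where
    0<y-x : 0# < y - x
    0<y-x = proj₂ <-resp-≈ (-‿inverseʳ x) (+-monoˡ-< (- x) x<y)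
    eq : c * (y - x) + c * x ≈ c * y
    eq = trans (sym (distribˡ c (y - x) x)) (*-congˡ (cancel y x))

  *⁻¹-cancel : ∀ {c} x → 0# < c → c * (x * c ⁻¹) ≈ x
  *⁻¹-cancel {c} x 0<c = trans (*-comm c _) (trans (*-assoc x (c ⁻¹) c)
    (trans (*-congˡ (trans (*-comm _ c) (⁻¹-inverseʳ λ c≈0 → irrefl (sym c≈0) 0<c)))
           (trans (*-comm x 1#) (*-identityˡ x))))

  x≤c*y⇒x*c⁻¹≤y : ∀ {c x y} → 0# < c → x ≤ c * y → x * c ⁻¹ ≤ y
  x≤c*y⇒x*c⁻¹≤y {c} {x} 0<c x≤cy = ≮⇒≥ λ y<x/c →
    <⇒≱ (proj₁ <-resp-≈ (*⁻¹-cancel x 0<c) (*-monoˡ-< 0<c y<x/c)) x≤cy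

  x*c⁻¹≤y⇒x≤c*y : ∀ {c x y} → 0# < c → x * c ⁻¹ ≤ y → x ≤ c * y
  x*c⁻¹≤y⇒x≤c*y {c} {x} 0<c x/c≤y = ≤-respˡ-≈ (*⁻¹-cancel x 0<c) (*-monoˡ-≤ (inj₁ 0<c) x/c≤y)

  sum-mono-≤ : ∀ {f g : Fin n → Carrier} → (∀ i → f i ≤ g i) → sum f ≤ sum g
  sum-mono-≤ {zero}  f≤g = ≤-refl
  sum-mono-≤ {suc n} f≤g = +-mono-≤ (f≤g zero) (sum-mono-≤ (f≤g ∘ suc))

  sum-nonneg : ∀ {f : Fin n → Carrier} → (∀ i → 0# ≤ f i) → 0# ≤ sum f
  sum-nonneg {zero}  0≤f = ≤-refl
  sum-nonneg {suc n} 0≤f = ≤-respˡ-≈ (+-identityˡ 0#) (+-mono-≤ (0≤f zero) (sum-nonneg (0≤f ∘ suc)))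

  term≤sum : ∀ {f : Fin n → Carrier} → (∀ i → 0# ≤ f i) → ∀ i → f i ≤ sum f
  term≤sum 0≤f zero    = ≤-respˡ-≈ (+-identityʳ _) (+-mono-≤ ≤-refl (sum-nonneg (0≤f ∘ suc)))
  term≤sum 0≤f (suc i) = ≤-respˡ-≈ (+-identityˡ _) (+-mono-≤ (0≤f zero) (term≤sum (0≤f ∘ suc) i))

  sum-pos : .{{_ : NonZero n}} {f : Fin n → Carrier} → (∀ i → 0# < f i) → 0# < sum f
  sum-pos {suc n} 0<f with term≤sum (inj₁ ∘ 0<f) zero
  ... | inj₁ f₀<s = <-trans (0<f zero) f₀<s
  ... | inj₂ f₀≈s = proj₁ <-resp-≈ f₀≈s (0<f zero)

  foldl-+≈ : ∀ a (f : Fin n → Carrier) → Vector.foldl _+_ a f ≈ a + sum f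
  foldl-+≈ {zero}  a f = sym (+-identityʳ a)
  foldl-+≈ {suc n} a f = trans (foldl-+≈ (a + f zero) (f ∘ suc)) (+-assoc a (f zero) (sum (f ∘ suc)))

  foldl-0≈sum : (f : Fin n → Carrier) → Vector.foldl _+_ 0# f ≈ sum f
  foldl-0≈sum f = trans (foldl-+≈ 0# f) (+-identityˡ (sum f))

  if-nonneg : ∀ b {x} → (b ≡ true → 0# < x) → 0# ≤ (if b then x else 0#)
  if-nonneg true  0<x = inj₁ (0<x ≡.refl)
  if-nonneg false 0<x = ≤-refl

  -- Maxima of functions with finitely many values

  FiniteValued : (X → Carrier) → Set
  FiniteValued f = ∃[ vs ] (∀ x → Any (f x ≈_) vs)

  finiteValued-if : (c : X → Bool) (a b : Carrier) → FiniteValued (λ x → if c x then a else b)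
  finiteValued-if c a b = a ∷ b ∷ [] , λ x → listed (c x)
    where
    listed : ∀ d → Any ((if d then a else b) ≈_) (a ∷ b ∷ [])
    listed true  = here refl
    listed false = there (here refl)

  finiteValued-sum : {f : X → Fin n → Carrier} →
                     (∀ i → FiniteValued (λ x → f x i)) → FiniteValued (λ x → sum (f x))
  finiteValued-sum {n = zero}  fv = 0# ∷ [] , λ _ → here refl
  finiteValued-sum {n = suc n} fv =
    let vs , v = fv zero ; ws , w = finiteValued-sum (fv ∘ suc) in
    cartesianProductWith _+_ vs ws , λ x → cartesianProductWith⁺ _+_ +-cong (v x) (w x)

  -- Starting from x, move to an argument with the first value of the list
  -- whenever that is an improvement; excluded middle decides whether there is one.
  maximum-attained : ∀ {f : X → Carrier} vs x → (∀ y → f x < f y → Any (f y ≈_) vs) →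
                     ¬ ¬ (∃[ z ] (∀ y → f y ≤ f z))
  maximum-attained []       x better none = none (x , λ y → ≮⇒≥ λ fx<fy → contradiction (better y fx<fy) λ ())
  maximum-attained {f = f} (v ∷ vs) x better none =
    ¬¬-excluded-middle {A = ∃[ z ] f x < f z × f z ≈ v} λ where
      (yes (z , fx<fz , fz≈v)) → maximum-attained vs z
        (λ y fz<fy → drop (λ fy≈v → irrefl (trans fz≈v (sym fy≈v)) fz<fy) (better y (<-trans fx<fz fz<fy))) none
      (no  ∄z) → maximum-attained vs x
        (λ y fx<fy → drop (λ fy≈v → ∄z (y , fx<fy , fy≈v)) (better y fx<fy)) none
    where
    drop : ∀ {y} → ¬ f y ≈ v → Any (f y ≈_) (v ∷ vs) → Any (f y ≈_) vs
    drop fy≉v (here fy≈v) = contradiction fy≈v fy≉v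
    drop _    (there p)   = p

  -- The given `pos` starts the search for a maximum; in the application it is the output of the
  -- approximation algorithm itself.
  OPT-exists : (I : Instance n) → let open Instance I in
               ∀ {pos} → IsRepresentation pos → ¬ ¬ ∃ IsOPT
  OPT-exists {n} I {pos} rep none =
    maximum-attained {X = ∃ IsRepresentation} {totalProfit ∘ proj₁}
      (proj₁ finite) (pos , rep) (λ y _ → proj₂ finite y)
      λ ((pos* , rep*) , max) → none (totalProfit pos* , (pos* , rep* , refl) , λ pos rep → max (pos , rep))
    where
    open Instance I
    finite : FiniteValued {X = ∃ IsRepresentation} (totalProfit ∘ proj₁)
    finite = finiteValued-sum λ u → finiteValued-sum λ v →
      finiteValued-if (λ (pos , _) → ⌊ u Fin.<? v ⌋ ∧ adj u v ∧ ⌊ contact? (place pos u) (place pos v) ⌋)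
        (profit u v) 0#

  -- Agreement of the values is asked for only under `a`, because profits are symmetric on edges
  -- only.
  if²-cong : ∀ {a b c d x y} → a ≡ b → c ≡ d → (a ≡ true → x ≈ y) →
             (if a then (if c then x else 0#) else 0#) ≈ (if b then (if d then y else 0#) else 0#)
  if²-cong {false} ≡.refl ≡.refl x≈y = refl
  if²-cong {true} {c = false} ≡.refl ≡.refl x≈y = refl
  if²-cong {true} {c = true}  ≡.refl ≡.refl x≈y = x≈y ≡.refl

  if-flatten : ∀ {A : Set} (a? : Dec A) b c {x} →
    (if ⌊ a? ⌋ ∧ b ∧ c then x else 0#) ≡ (if does a? then (if b then (if c then x else 0#) else 0#) else 0#)
  if-flatten (no _)  b     c = ≡.refl
  if-flatten (yes _) false c = ≡.refl
  if-flatten (yes _) true  c = ≡.refl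

  -- The symmetric score against the objective.

  module _ (I : Instance n) (pos : Fin n → Point) where

    open Instance I

    gain-sym : ∀ u v → gain I pos u v ≈ gain I pos v u
    gain-sym u v = if²-cong (Graph.sym graph u v) (touch-sym (place pos u) (place pos v)) (profit-sym u v)

    summand : Fin n → Fin n → Carrier
    summand u v = if ⌊ u Fin.<? v ⌋ ∧ adj u v ∧ touch (place pos u) (place pos v) then profit u v else 0#

    -- This is `totalProfit` with its contact test hidden behind the opaque `touch`.
    value : Carrier
    value = sum λ u → sum (summand u)

    summand-nonneg : ∀ u v → 0# ≤ summand u v
    summand-nonneg u v = if-nonneg _ λ realised →
      profit-pos u v (∧-true₁ (∧-true₂ {⌊ u Fin.<? v ⌋} realised))
      where
      ∧-true₁ : ∀ {a b} → a ∧ b ≡ true → a ≡ true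
      ∧-true₁ {true} _ = ≡.refl
      ∧-true₂ : ∀ {a b} → a ∧ b ≡ true → b ≡ true
      ∧-true₂ {true} b = b

    summand≡ : ∀ u v → summand u v ≡ (if does (u Fin.<? v) then gain I pos u v else 0#)
    summand≡ u v = if-flatten (u Fin.<? v) (adj u v) (touch (place pos u) (place pos v))

    -- By trichotomy at most one summand survives; on the diagonal everything vanishes, as the graph
    -- has no loops.
    gain≈ : ∀ u v → gain I pos u v ≈ summand u v + summand v u
    gain≈ u v rewrite summand≡ u v | summand≡ v u with Fin.<-cmp u v
    ... | tri< u<v _ v≮u rewrite dec-true (u Fin.<? v) u<v | dec-false (v Fin.<? u) v≮u = sym (+-identityʳ _)
    ... | tri> u≮v _ v<u rewrite dec-false (u Fin.<? v) u≮v | dec-true (v Fin.<? u) v<u =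
      trans (gain-sym u v) (sym (+-identityˡ _))
    ... | tri≈ u≮u ≡.refl _ rewrite dec-false (u Fin.<? u) u≮u | Graph.irrefl graph u = sym (+-identityˡ _)

    score≈ : score I pos ≈ value + value
    score≈ = trans (foldl-0≈sum λ u → Vector.foldl _+_ 0# (gain I pos u)) (trans
      (sum-cong-≋ λ u → trans (foldl-0≈sum (gain I pos u)) (trans (sum-cong-≋ (gain≈ u)) (∑-distrib-+ (summand u) _)))
      (trans (∑-distrib-+ (λ u → sum (summand u)) _) (+-congˡ (∑-comm λ u v → summand v u))))

  -- Restriction to subgraphs and covers.

  restrict : (I : Instance n) (H : Graph n) →
             (∀ u v → Graph.adj H u v ≡ true → Instance.adj I u v ≡ true) → Instance n
  restrict I H H⊆I = record
    { Instance I
    ; graph      = H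
    ; profit-sym = λ u v uv → profit-sym u v (H⊆I u v uv)
    ; profit-pos = λ u v uv → profit-pos u v (H⊆I u v uv)
    }
    where open Instance I

  module _ (I : Instance n) (pos : Fin n → Point) where

    open Instance I

    -- Edges outside `H` that happen to be realized have positive profit.
    value-restrict-≤ : ∀ H H⊆I → value (restrict I H H⊆I) pos ≤ value I pos
    value-restrict-≤ H H⊆I = sum-mono-≤ λ u → sum-mono-≤ λ v →
      restrict-≤ ⌊ u Fin.<? v ⌋ (Graph.adj H u v) (adj u v) (touch (place pos u) (place pos v))
        (H⊆I u v) (profit-pos u v)
      where
      restrict-≤ : ∀ a b c d → (b ≡ true → c ≡ true) → ∀ {x} → (c ≡ true → 0# < x) →
        (if a ∧ b ∧ d then x else 0#) ≤ (if a ∧ c ∧ d then x else 0#)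
      restrict-≤ false b     c     d b⇒c 0<x = ≤-refl
      restrict-≤ true  true  c     d b⇒c 0<x rewrite b⇒c ≡.refl = ≤-refl
      restrict-≤ true  false true  d b⇒c 0<x = if-nonneg d λ _ → 0<x ≡.refl
      restrict-≤ true  false false d b⇒c 0<x = ≤-refl

    -- The covering graphs may overlap, so an edge can count several times on the right; one
    -- occurrence suffices, the other summands being nonnegative.
    value-cover-≤ : (Hs : Fin k → Graph n) (cover : Hs Covers graph)
      (⊆ : ∀ i u v → Graph.adj (Hs i) u v ≡ true → adj u v ≡ true) →
      value I pos ≤ sum (λ i → value (restrict I (Hs i) (⊆ i)) pos)
    value-cover-≤ Hs cover ⊆ = ≤-respʳ-≈ swap (sum-mono-≤ λ u → sum-mono-≤ λ v → covered u v)
      where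
      restricted = λ i → summand (restrict I (Hs i) (⊆ i)) pos
      swap : sum (λ u → sum λ v → sum λ i → restricted i u v) ≈ sum (λ i → sum λ u → sum λ v → restricted i u v)
      swap = trans (sum-cong-≋ λ u → ∑-comm λ v i → restricted i u v)
                   (∑-comm λ u i → sum (restricted i u))
      -- With the adjacency bit as a variable, the bit of the covering graph can be exchanged for
      -- that of the whole graph.
      withAdj : Fin n → Fin n → Bool → Carrier
      withAdj u v b = if ⌊ u Fin.<? v ⌋ ∧ b ∧ touch (place pos u) (place pos v) then profit u v else 0#
      summand≤ : ∀ u v b → adj u v ≡ b → withAdj u v b ≤ sum (λ i → restricted i u v)
      summand≤ u v true uv =
        let i , uvᵢ = Equivalence.to (cover u v) uv in
        subst (λ b → withAdj u v b ≤ sum (λ i → restricted i u v)) uvᵢ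
          (term≤sum (λ i → summand-nonneg (restrict I (Hs i) (⊆ i)) pos u v) i)
      summand≤ u v false uv rewrite ∧-zeroʳ ⌊ u Fin.<? v ⌋ =
        sum-nonneg λ i → summand-nonneg (restrict I (Hs i) (⊆ i)) pos u v
      covered : ∀ u v → summand I pos u v ≤ sum (λ i → restricted i u v)
      covered u v = summand≤ u v (adj u v) ≡.refl

  -- Two forms of the approximation guarantee.

  approximation-bound : (I : Instance n) → let open Instance I in
    ∀ {α pos} → 0# < α → IsRepresentation pos → (∀ m → IsOPT m → m * α ⁻¹ ≤ totalProfit pos) →
    ∀ pos′ → IsRepresentation pos′ → value I pos′ ≤ α * value I pos
  approximation-bound I {α} {pos} 0<α rep approx pos′ rep′ =
    ≡.subst₂ (λ s t → s ≤ α * t) (totalProfit-touch I pos′) (totalProfit-touch I pos)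
      (decidable-stable (_ ≤? _) λ ≰ → OPT-exists I rep λ (m , opt@(_ , max)) →
        ≰ (≤-trans (max pos′ rep′) (x*c⁻¹≤y⇒x≤c*y 0<α (approx m opt))))

  -- An optimum is attained, so the bound applies to a representation attaining it.
  approximation-ratio : (I : Instance n) → let open Instance I in
    ∀ {α pos} → 0# < α → (∀ pos′ → IsRepresentation pos′ → value I pos′ ≤ α * value I pos) →
    ∀ m → IsOPT m → m * α ⁻¹ ≤ totalProfit pos
  approximation-ratio I {α} {pos} 0<α bound m ((pos* , rep* , pos*≈m) , _) =
    x≤c*y⇒x*c⁻¹≤y 0<α (≤-respˡ-≈ pos*≈m
      (≡.subst₂ (λ s t → s ≤ α * t) (≡.sym (totalProfit-touch I pos*)) (≡.sym (totalProfit-touch I pos))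
        (bound pos* rep*)))

  -- Approximation with respect to every representation instead of an optimum.
  _AdmitsValueApproximation_ : Problem → Carrier → Set
  P AdmitsValueApproximation α =
    Σ[ A ∈ Prog ] ∃[ a ] ∃[ b ] (∀ (x : Input) →
      let open Instance (instanceOf x) in
      ∃[ pos ] ∃[ t ]
        (A ⊢ encode x ⇓ encodePositions pos ∣ t) ×
        (t ℕ.≤ a ℕ.* size (encode x) ℕ.^ b) ×
        IsRepresentation pos ×
        (∀ pos′ → IsRepresentation pos′ → value (instanceOf x) pos′ ≤ α * value (instanceOf x) pos))
    where open Problem P

  toValueApproximation : ∀ P α → 0# < α → P AdmitsApproximation α → P AdmitsValueApproximation α
  toValueApproximation P α 0<α (A , a , b , approx) = A , a , b , λ x →
    let pos , t , run , t≤ , rep , ratio = approx x in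
    pos , t , run , t≤ , rep , approximation-bound (Problem.instanceOf P x) {α} {pos} 0<α rep ratio

  fromValueApproximation : ∀ P α → 0# < α → P AdmitsValueApproximation α → P AdmitsApproximation α
  fromValueApproximation P α 0<α (A , a , b , approx) = A , a , b , λ x →
    let pos , t , run , t≤ , rep , bound = approx x in
    pos , t , run , t≤ , rep , approximation-ratio (Problem.instanceOf P x) {α} {pos} 0<α bound

-- Running the given algorithms on the parts and selecting the best output.

module Combination (R : RealNumbers) where

  open ≡ using (refl)
  open RealNumbers R
  open MaxCrown R
  open Execution R
  open Bounds R
  open IsStrictTotalOrder isStrictTotalOrder using () renaming (_<?_ to _<ᵣ?_)
  open TotalOrder totalOrder using (≤-respˡ-≈; ≤-respʳ-≈)
    renaming (trans to ≤-trans; refl to ≤-refl)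
  open CommutativeRing commutativeRing using (semiring; sym)
  open import Algebra.Properties.Semiring.Sum semiring using (sum; *-distribʳ-sum)

  encodeEdges : ∀ {n} → Instance n → Fin n → Fin n → Data
  encodeEdges I u v = if Instance.adj I u v then num (Instance.profit I u v) else nil

  mask-runs : ∀ {n} (I : Instance n) H H⊆I u v →
    maskᴾ ⊢ nil ∷ (encodeEdges I u v ∷ (if Graph.adj H u v then nil ∷ nil else nil))
          ↦ encodeEdges (restrict I H H⊆I) u v
  mask-runs I H H⊆I u v with Graph.adj H u v | H⊆I u v
  ... | false | _ = _ , cond-false (seq tl tl) nil
  ... | true  | H⊆I rewrite H⊆I refl = _ , cond-true (seq tl tl) (λ ()) (seq tl hd)

  -- The conditional stands under `enc`, so that a selection is again the encoding of one family of
  -- positions; `A` varies with `x` as their number does.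
  if-PolyTime : ∀ {X : Set} {D : X → Data} {c p q} {A : X → Set} (enc : ∀ x → A x → Data)
                {f} (b : X → Bool) {y z : ∀ x → A x} →
                PolyTime D c f (bool ∘ b) → PolyTime D p f (λ x → enc x (y x)) →
                PolyTime D q f (λ x → enc x (z x)) →
                PolyTime D (cond c p q) f (λ x → enc x (if b x then y x else z x))
  if-PolyTime {D = D} {c} {p} {q} {A} enc {f} b {y} {z} C P Q = polyTime
    (Poly-+ {D = D} (Poly-const {D = D} 1)
      (Poly-+ {D = D} (PolyTime.isPoly C) (Poly-+ {D = D} (PolyTime.isPoly P) (PolyTime.isPoly Q))))
    λ x → branch x (b x) (PolyTime.runs C x)
    where
    branch : ∀ x b → c ⊢ f x ↦ bool b within PolyTime.time C x →
             cond c p q ⊢ f x ↦ enc x (if b then y x else z x) within _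
    branch x true (_ , E , s≤) = let _ , F , t≤ = PolyTime.runs P x in
      _ , cond-true E (λ ()) F , s≤s (ℕ.+-mono-≤ s≤ (ℕ.≤-trans t≤ (ℕ.m≤m+n _ _)))
    branch x false (_ , E , s≤) = let _ , F , t≤ = PolyTime.runs Q x in
      _ , cond-false E F , s≤s (ℕ.+-mono-≤ s≤ (ℕ.≤-trans t≤ (ℕ.m≤n+m _ (PolyTime.time P x))))

  score≤⇒value≤ : ∀ {n} (I : Instance n) {pos pos′} →
                  score I pos ≤ score I pos′ → value I pos ≤ value I pos′
  score≤⇒value≤ I {pos} {pos′} le = halve-≤ (≤-respˡ-≈ (score≈ I pos) (≤-respʳ-≈ (score≈ I pos′) le))

  module _ {k : ℕ} (𝒢 : Fin k → GraphClass) where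

    open CoveredInstance
    open Problem (MaxCrownOnCovered 𝒢) using (encode)

    n≤size : ∀ (x : CoveredInstance 𝒢) → n x ℕ.≤ size (encode x)
    n≤size x = ℕ.≤-trans (length≤size λ v → num (Instance.w (inst x) v) ∷ num (Instance.h (inst x) v))
      (ℕ.≤-trans (ℕ.m≤m+n _ _) (ℕ.≤-trans (ℕ.n≤1+n _) (ℕ.≤-trans (ℕ.m≤m+n _ _) (ℕ.n≤1+n _))))

    -- No guarantee is included: it is tracked separately through `profitOf`, which lets selection
    -- be iterated.
    record Algorithm : Set where
      field
        program          : Prog
        positions        : ∀ (x : CoveredInstance 𝒢) → Fin (n x) → Point
        runs             : PolyTime encode program encode (encodePositions ∘ positions)
        isRepresentation : ∀ x → Instance.IsRepresentation (inst x) (positions x)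

    open Algorithm

    profitOf : Algorithm → CoveredInstance 𝒢 → Carrier
    profitOf A x = value (inst x) (positions A x)

    module _ (A B : Algorithm) where

      scoreOf : Algorithm → CoveredInstance 𝒢 → Carrier
      scoreOf C x = score (inst x) (positions C x)

      select : Algorithm
      select = record
        { program   = selectᴾ (program A) (program B)
        ; positions = λ x → if does (scoreOf A x <ᵣ? scoreOf B x) then positions B x else positions A x
        ; runs      = ⨾-PolyTime
            (pair-PolyTime (loopFree⇒PolyTime λ _ → _ , id) (pair-PolyTime (runs A) (runs B)))
            (if-PolyTime {A = λ x → Fin (n x) → Point} (λ _ → encodePositions)
              (λ x → does (scoreOf A x <ᵣ? scoreOf B x)) {positions B} {positions A}
              (⨾-PolyTime
                (pair-PolyTime
                  (⨾-PolyTime (loopFree⇒PolyTime λ _ → _ , pair (seq hd hd) (seq tl hd))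
                              (score-PolyTime n≤size inst (positions A)))
                  (⨾-PolyTime (loopFree⇒PolyTime λ _ → _ , pair (seq hd hd) (seq tl tl))
                              (score-PolyTime n≤size inst (positions B))))
                (loopFree⇒PolyTime λ x → <-runs (scoreOf A x) (scoreOf B x)))
              (loopFree⇒PolyTime λ _ → _ , seq tl tl)
              (loopFree⇒PolyTime λ _ → _ , seq tl hd))
        ; isRepresentation = λ x → chosen x (does (scoreOf A x <ᵣ? scoreOf B x))
        }
        where
        chosen : ∀ x b → Instance.IsRepresentation (inst x) (if b then positions B x else positions A x)
        chosen x true  = isRepresentation B x
        chosen x false = isRepresentation A x

      select-≥ : ∀ x → profitOf A x ≤ profitOf select x × profitOf B x ≤ profitOf select x
      select-≥ x = chosen (scoreOf A x <ᵣ? scoreOf B x)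
        where
        chosen : (A<B? : Dec (scoreOf A x < scoreOf B x)) →
          let pos = if does A<B? then positions B x else positions A x in
          profitOf A x ≤ value (inst x) pos × profitOf B x ≤ value (inst x) pos
        chosen (yes A<B) = score≤⇒value≤ (inst x) {positions A x} {positions B x} (inj₁ A<B) , ≤-refl
        chosen (no  A≮B) = ≤-refl , score≤⇒value≤ (inst x) {positions B x} {positions A x} (≮⇒≥ A≮B)

    -- Selection needs a first candidate, hence `suc m`. The nesting depth is fixed by the family,
    -- so the time remains polynomial.
    best : ∀ {m} (As : Fin (suc m) → Algorithm) →
           ∃[ B ] (∀ i x → profitOf (As i) x ≤ profitOf B x)
    best {zero}  As = As zero , λ where zero x → ≤-refl
    best {suc m} As with best (As ∘ suc)
    ... | B , As≤B = select (As zero) B , λ where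
      zero    x → proj₁ (select-≥ (As zero) B x)
      (suc i) x → ≤-trans (As≤B i x) (proj₂ (select-≥ (As zero) B x))

    cover⊆ : ∀ (x : CoveredInstance 𝒢) i u v →
             Graph.adj (cover x i) u v ≡ true → Instance.adj (inst x) u v ≡ true
    cover⊆ x i u v uv = Equivalence.from (covers x u v) (i , uv)

    part : Fin k → ∀ (x : CoveredInstance 𝒢) → Instance (n x)
    part i x = restrict (inst x) (cover x i) (cover⊆ x i)

    restrict-PolyTime : ∀ i → PolyTime encode (restrictToᴾ i) encode (λ x → encodeInstance (part i x))
    restrict-PolyTime i = pair-PolyTime
      (loopFree⇒PolyTime λ _ → _ , seq hd hd)
      (⨾-PolyTime
        (pair-PolyTime (loopFree⇒PolyTime λ _ → _ , seq hd tl)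
          -- For a variable `i` the loop-freeness of `nthᴾ i` does not compute and is supplied by
          -- induction.
          (loopFree⇒PolyTime {_} {_} {_} {_} {_} {nth-loopFree i}
            λ x → ⨾-↦ (_ , tl) (nth-runs (encodeGraph ∘ cover x) i)))
        (⨾-PolyTime (loopFree⇒PolyTime λ _ → _ , pair nil id)
          (zip-PolyTime n≤size (λ _ → nil) (λ x u → list (encodeEdges (inst x) u))
            (λ x u → list λ v → if Graph.adj (cover x i) u v then nil ∷ nil else nil)
            (λ x u → list (encodeEdges (part i x) u))
            (⨾-PolyTime (loopFree⇒PolyTime λ _ → _ , pair nil tl)
              (zip-PolyTime (n≤size ∘ proj₁) _ _ _ _
                (loopFree⇒PolyTime λ ((x , u) , v) → mask-runs (inst x) (cover x i) (cover⊆ x i) u v))))))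

    -- This turns the polynomial of a given algorithm, stated in the size of its own input, into one
    -- in the size of the whole input. Masking is harmless as `num` and `nil` both have size 1.
    size-part : ∀ i (x : CoveredInstance 𝒢) → size (encodeInstance (part i x)) ℕ.≤ size (encode x)
    size-part i x = ℕ.≤-trans
      (s≤s (ℕ.+-monoʳ-≤ (size (list λ v → num (w v) ∷ num (h v)))
        (list-size-mono λ u → list-size-mono λ v → entry u v)))
      (ℕ.≤-trans (ℕ.m≤m+n _ _) (ℕ.n≤1+n _))
      where
      open Instance (inst x) using (w; h; adj)
      entry : ∀ u v → size (encodeEdges (part i x) u v) ℕ.≤ size (encodeEdges (inst x) u v)
      entry u v = ℕ.≤-reflexive (≡.trans (size-if (Graph.adj (cover x i) u v)) (≡.sym (size-if (adj u v))))
        where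
        size-if : ∀ b {y} → size (if b then num y else nil) ≡ 1
        size-if true  = refl
        size-if false = refl

    module _ (α : Fin k → Carrier) (𝒜 : ∀ i → MaxCrownOn (𝒢 i) AdmitsValueApproximation α i) where

      onPart : Fin k → Algorithm
      onPart i =
        let A , a , b , approx = 𝒜 i
            input = λ (x : CoveredInstance 𝒢) → n x , part i x , member x i in
        record
        { program   = restrictToᴾ i ⨾ A
        ; positions = λ x → proj₁ (approx (input x))
        ; runs      = ⨾-PolyTime (restrict-PolyTime i)
            (polyTime (Poly-* {D = encode} (Poly-const {D = encode} a) (1 , b , λ x →
              ℕ.≤-trans (ℕ.^-monoˡ-≤ b (size-part i x)) (ℕ.≤-reflexive (≡.sym (ℕ.*-identityˡ _)))))
              λ x → let _ , t , E , t≤ , _ = approx (input x) in t , E , t≤)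
        ; isRepresentation = λ x → let _ , _ , _ , _ , rep , _ = approx (input x) in rep
        }

      part-bound : (∀ i → 0# < α i) → ∀ i (x : CoveredInstance 𝒢) pos → Instance.IsRepresentation (inst x) pos →
                   value (part i x) pos ≤ α i * profitOf (onPart i) x
      part-bound 0<α i x pos rep =
        let _ , _ , _ , _ , _ , bound = proj₂ (proj₂ (proj₂ (𝒜 i))) (n x , part i x , member x i) in
        ≤-trans (bound pos rep)
          (RealProperties.*-monoˡ-≤ R (inj₁ (0<α i))
            (value-restrict-≤ (inst x) (positions (onPart i) x) (cover x i) (cover⊆ x i)))

  combination : ∀ k .{{_ : NonZero k}} (𝒢 : Fin k → GraphClass) (α : Fin k → Carrier) →
    (∀ i → 0# < α i) → (∀ i → MaxCrownOn (𝒢 i) AdmitsValueApproximation α i) →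
    MaxCrownOnCovered 𝒢 AdmitsValueApproximation (∑[ i < k ] α i)
  combination (suc k) 𝒢 α 0<α 𝒜 =
    let B , parts≤B = best 𝒢 (onPart 𝒢 α 𝒜)
        polyTime (a , b , t≤) runs′ = Algorithm.runs B in
    Algorithm.program B , a , b , λ x →
      let t , E , t≤′ = runs′ x in
      Algorithm.positions B x , t , E , ℕ.≤-trans t≤′ (t≤ x) , Algorithm.isRepresentation B x , λ pos rep →
        ≤-trans (value-cover-≤ (inst x) pos (cover x) (covers x) (cover⊆ 𝒢 x))
          (≤-respʳ-≈ (sym (*-distribʳ-sum (profitOf 𝒢 B x) α))
            (sum-mono-≤ {f = λ i → value (part 𝒢 i x) pos} {g = λ i → α i * profitOf 𝒢 B x} λ i →
              ≤-trans (part-bound 𝒢 α 𝒜 0<α i x pos rep)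
                (RealProperties.*-monoˡ-≤ R (inj₁ (0<α i)) (parts≤B i x))))
    where open CoveredInstance

lemma1 : (R : RealNumbers) →
    let open RealNumbers R
        open MaxCrown R in
    (k : ℕ) .{{_ : NonZero k}}
    (𝒢 : Fin k → GraphClass) (α : Fin k → Carrier) →
    (∀ i → 0# < α i) →
    (∀ i → MaxCrownOn (𝒢 i) AdmitsApproximation α i) →
    MaxCrownOnCovered 𝒢 AdmitsApproximation (∑[ i < k ] α i)
lemma1 R k 𝒢 α 0<α 𝒜 =
  fromValueApproximation (MaxCrownOnCovered 𝒢) (∑[ i < k ] α i) (sum-pos 0<α)
    (combination k 𝒢 α 0<α λ i → toValueApproximation (MaxCrownOn (𝒢 i)) (α i) (0<α i) (𝒜 i))
  where
  open MaxCrown R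
  open Bounds R
  open Combination R
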